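{- Let $F=(V,E)$ be a forest with at most one isolated vertex. If the set $\{v\in V \mid d_F(v)\neq 2\}$ is an independent set in $F$ (where $d_F(v)$ denotes the degree of $v$ in $F$), then $F$ admits an antimagic orientation.
   Context: All graphs are finite and simple, and digraphs are orientations of simple graphs. Let $D$ be a digraph with $m$ arcs and arc set $A(D)$. For a bijection $\tau:A(D)\to\{1,2,\ldots,m\}$ and a vertex $v$, the oriented vertex-sum $s_{(D,\tau)}(v)$ is the sum of the labels $\tau(e)$ over all arcs $e$ entering $v$ minus the sum of the labels $\tau(e)$ over all arcs $e$ leaving $v$. The bijection $\tau$ is an antimagic labeling of $D$ if $s_{(D,\tau)}(u)\neq s_{(D,\tau)}(v)$ for all distinct vertices $u,v$ of $D$. A graph $G$ admits an antimagic orientation if $G$ has an orientation $D$ such that $D$ has an antimagic labeling. An isolated vertex is a vertex of degree $0$. -}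

module Defs where

open import Level using (0ℓ)
open import Data.Bool.Base using (Bool; T)
open import Data.Bool.Properties using (T?)
open import Data.Nat.Base as ℕ using (ℕ; zero; suc)
import Data.Nat.Properties as ℕ
open import Data.Integer.Base as ℤ using (ℤ; +_)
open import Data.Fin.Base using (Fin; zero; suc; toℕ; inject₁; fromℕ)
open import Data.Fin.Subset using (Subset; ∣_∣)
open import Data.Vec.Base using (tabulate)
open import Data.Product.Base using (_×_; Σ-syntax; ∃-syntax; _,_)
open import Data.Sum.Base using (_⊎_)
open import Function.Base using (_∘_)
open import Function.Bundles using (_⇔_; _⤖_; module Bijection)
open import Function.Definitions using (Injective)
open import Relation.Binary.Core using (Rel)
open import Relation.Binary.Definitions using (Symmetric; Asymmetric)
open import Relation.Binary.PropositionalEquality using (_≡_; _≢_)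
open import Relation.Nullary using (¬_; yes; no)
open import Relation.Unary using (Pred)
open import Algebra.Properties.CommutativeMonoid.Sum ℕ.+-0-commutativeMonoid using (sum)

-- Adjacency is Boolean-valued, so that proofs of adjacency are unique.
record Graph (n : ℕ) : Set where
  field
    adj : Fin n → Fin n → Bool

  Adj : Rel (Fin n) 0ℓ
  Adj u v = T (adj u v)

  field
    symmetric   : Symmetric Adj
    irreflexive : ∀ v → ¬ Adj v v

  neighbours : Fin n → Subset n
  neighbours v = tabulate (adj v)

  degree : Fin n → ℕ
  degree v = ∣ neighbours v ∣

  Isolated : Pred (Fin n) 0ℓ
  Isolated v = degree v ≡ 0

  Independent : Pred (Fin n) 0ℓ → Set
  Independent S = ∀ u v → S u → S v → ¬ Adj u v

  -- The vertices in cyclic order; the cycle has length 3 + k.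
  record Cycle : Set where
    field
      k        : ℕ
      vertex   : Fin (3 ℕ.+ k) → Fin n
      distinct : Injective _≡_ _≡_ vertex
      step     : ∀ (i : Fin (2 ℕ.+ k)) → Adj (vertex (inject₁ i)) (vertex (suc i))
      close    : Adj (vertex (fromℕ (2 ℕ.+ k))) (vertex zero)

  IsForest : Set
  IsForest = ¬ Cycle

-- Asymmetry rules out both loops and opposite arcs, so these are exactly the
-- orientations of simple graphs.
record Digraph (n : ℕ) : Set where
  field
    arc : Fin n → Fin n → Bool

  -- u ⟶ v is an arc leaving u and entering v.
  _⟶_ : Rel (Fin n) 0ℓ
  u ⟶ v = T (arc u v)

  field
    asymmetric : Asymmetric _⟶_

  Arc : Set
  Arc = Σ[ (u , v) ∈ Fin n × Fin n ] u ⟶ v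

  module _ (label : Arc → ℕ) where

    -- The label of the arc from u to v, or 0 if there is no such arc.
    labelAt : Fin n → Fin n → ℕ
    labelAt u v with T? (arc u v)
    ... | yes a = label ((u , v) , a)
    ... | no  _ = 0

    vertexSum : Fin n → ℤ
    vertexSum v = + sum (λ u → labelAt u v) ℤ.- + sum (λ w → labelAt v w)

  -- Fin m stands for {1, …, m} through i ↦ 1 + toℕ i.
  labelling : ∀ {m} → Arc ⤖ Fin m → Arc → ℕ
  labelling τ = suc ∘ toℕ ∘ Bijection.to τ

  IsAntimagic : ∀ {m} → Arc ⤖ Fin m → Set
  IsAntimagic τ = ∀ u v → u ≢ v → vertexSum (labelling τ) u ≢ vertexSum (labelling τ) v

  -- The bijection forces m to be the number of arcs.
  HasAntimagicLabeling : Set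
  HasAntimagicLabeling = ∃[ m ] Σ[ τ ∈ Arc ⤖ Fin m ] IsAntimagic τ

_IsOrientationOf_ : ∀ {n} → Digraph n → Graph n → Set
D IsOrientationOf G = ∀ u v → Adj u v ⇔ (u ⟶ v ⊎ v ⟶ u)
  where
  open Graph G
  open Digraph D

AdmitsAntimagicOrientation : ∀ {n} → Graph n → Set
AdmitsAntimagicOrientation {n} G =
  Σ[ D ∈ Digraph n ] D IsOrientationOf G × Digraph.HasAntimagicLabeling D

{-# OPTIONS --safe #-}

-- Delete vertices one by one, each having at most one neighbour left, so that the last vertex
-- of every component has degree other than 2; this roots the forest. Choose as hubs all
-- vertices of degree other than 2 and some vertices of degree 2, so that hubs are joined by
-- paths with one inner vertex v, or two inner vertices v, u with v nearer to the root. Direct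
-- all edges at hubs towards the hubs, and v → u. With ℓ x the label of the edge from x to its
-- parent (0 for a root), a hub w has the sum ℓ w + Σ ℓ c over its children c; the inner vertices
-- v and u, with children c and c′, have the negative sums - (ℓ v + ℓ c) and - (ℓ c′ - ℓ u).
--
-- Give the edges below the vertices v the smallest labels, those below the vertices u the next
-- ones, and those below hubs the largest ones, ordered first by the number of children of the
-- hub and then by its own label. Then the sums of hubs are ordered in the same way: every label
-- below a later hub exceeds all labels at an earlier one. Take the edges below the vertices v in
-- the order of the edges above them, and the edges below the vertices u in the reverse order.
-- Then ℓ v + ℓ c increases and ℓ c′ - ℓ u decreases strictly in this order, and
-- ℓ c′ < ℓ v′ for any vertices u and v′ keeps the two families of sums apart.
module Submission where

open import Defs
open import Level using (0ℓ)
open import Data.Nat.Base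
open import Data.Nat.Properties hiding (0≢1+n; suc-injective)
import Data.Nat.Properties as ℕ
open import Algebra.Properties.Semiring.Sum +-*-semiring
  using (sum; sum-cong-≗; ∑-distrib-+; *-distribʳ-sum; sum-replicate-zero)
open import Data.Bool.Base using (Bool; true; false; T; if_then_else_; _∧_)
open import Data.Bool.Properties using (T?; T-∧; T-irrelevant)
open import Data.Empty using (⊥)
open import Data.Fin.Base using (Fin; zero; suc; toℕ; fromℕ<; punchOut)
open import Data.Fin.Properties
  using (any?; all?; 0≢1+n; suc-injective; toℕ-inject₁; toℕ-fromℕ; toℕ-fromℕ<; toℕ-injective; toℕ<n;
         fromℕ<-injective; punchOut-injective; injective⇒≤)
  renaming (_≟_ to _≟ᶠ_)
open import Data.Fin.Subset using (∣_∣)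
open import Data.Integer.Base as ℤ using (+_)
import Data.Integer.Properties as ℤ
open import Data.Integer.Tactic.RingSolver using (solve-∀)
open import Data.Product.Base using (_×_; _,_; proj₁; proj₂; ∃-syntax)
open import Data.Sum.Base using (_⊎_; inj₁; inj₂; [_,_]; swap; map)
open import Data.Unit.Base using (⊤; tt)
open import Data.Vec.Base using (tabulate)
open import Function.Base using (_∘_)
open import Function.Bundles using (_⤖_; mk⤖; mk⇔; module Equivalence)
open import Function.Consequences.Propositional using (strictlySurjective⇒surjective)
open import Function.Definitions using (Injective)
open import Relation.Binary.Definitions using (tri<; tri≈; tri>)
open import Relation.Binary.PropositionalEquality hiding ([_])
open import Relation.Nullary using (¬_; Dec; yes; no; does; contradiction; ¬?; _×-dec_; _→-dec_)
open import Relation.Nullary.Decidable using (dec-true; dec-false; decidable-stable)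
open import Relation.Unary using (Pred; Decidable)

open Graph

-- Restricted sums

private
  variable
    n : ℕ

sum-mono-≤ : {f g : Fin n → ℕ} → (∀ i → f i ≤ g i) → sum f ≤ sum g
sum-mono-≤ {zero}  f≤g = z≤n
sum-mono-≤ {suc n} f≤g = +-mono-≤ (f≤g zero) (sum-mono-≤ (f≤g ∘ suc))

sum-mono-< : {f g : Fin n → ℕ} → (∀ i → f i ≤ g i) → ∀ i → f i < g i → sum f < sum g
sum-mono-< f≤g zero    fᵢ<gᵢ = +-mono-<-≤ fᵢ<gᵢ (sum-mono-≤ (f≤g ∘ suc))
sum-mono-< f≤g (suc i) fᵢ<gᵢ = +-mono-≤-< (f≤g zero) (sum-mono-< (f≤g ∘ suc) i fᵢ<gᵢ)

sum-zero : {f : Fin n → ℕ} → (∀ i → f i ≡ 0) → sum f ≡ 0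
sum-zero {n} f≡0 = trans (sum-cong-≗ f≡0) (sum-replicate-zero n)

restrict : {A : Set} → Dec A → ℕ → ℕ
restrict A? x = if does A? then x else 0

restrict-yes : {A : Set} (A? : Dec A) → A → ∀ x → restrict A? x ≡ x
restrict-yes A? a x rewrite dec-true A? a = refl

restrict-no : {A : Set} (A? : Dec A) → ¬ A → ∀ x → restrict A? x ≡ 0
restrict-no A? ¬a x rewrite dec-false A? ¬a = refl

sumOver : {P : Pred (Fin n) 0ℓ} → Decidable P → (Fin n → ℕ) → ℕ
sumOver P? f = sum (λ u → restrict (P? u) (f u))

count : {P : Pred (Fin n) 0ℓ} → Decidable P → ℕ
count P? = sumOver P? (λ _ → 1)

restrict-mono-≤ : {A B : Set} (A? : Dec A) (B? : Dec B) {x y : ℕ} →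
  (A → B × x ≤ y) → restrict A? x ≤ restrict B? y
restrict-mono-≤ (no _)  B? h = z≤n
restrict-mono-≤ (yes a) B? {y = y} h with b , x≤y ← h a =
  ≤-trans x≤y (≤-reflexive (sym (restrict-yes B? b y)))

sumOver-mono-≤ : {P Q : Pred (Fin n) 0ℓ} (P? : Decidable P) (Q? : Decidable Q) {f g : Fin n → ℕ} →
  (∀ u → P u → Q u × f u ≤ g u) → sumOver P? f ≤ sumOver Q? g
sumOver-mono-≤ P? Q? h = sum-mono-≤ (λ u → restrict-mono-≤ (P? u) (Q? u) (h u))

count-mono-≤ : {P Q : Pred (Fin n) 0ℓ} (P? : Decidable P) (Q? : Decidable Q) →
  (∀ u → P u → Q u) → count P? ≤ count Q?
count-mono-≤ P? Q? P⊆Q = sumOver-mono-≤ P? Q? (λ u p → P⊆Q u p , ≤-refl)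

count-mono-< : {P Q : Pred (Fin n) 0ℓ} (P? : Decidable P) (Q? : Decidable Q) →
  (∀ u → P u → Q u) → ∀ u → ¬ P u → Q u → count P? < count Q?
count-mono-< P? Q? P⊆Q u ¬p q =
  sum-mono-< (λ u → restrict-mono-≤ (P? u) (Q? u) (λ p → P⊆Q u p , ≤-refl)) u
    (subst₂ _<_ (sym (restrict-no (P? u) ¬p 1)) (sym (restrict-yes (Q? u) q 1)) z<s)

sumOver-const : {P : Pred (Fin n) 0ℓ} (P? : Decidable P) → ∀ k → sumOver P? (λ _ → k) ≡ count P? * k
sumOver-const P? k = trans (sum-cong-≗ (λ u → scale (P? u))) (sym (*-distribʳ-sum k (λ u → restrict (P? u) 1)))
  where
  scale : {A : Set} (A? : Dec A) → restrict A? k ≡ restrict A? 1 * k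
  scale (yes _) = sym (+-identityʳ k)
  scale (no _)  = refl

sumOver-empty : {P : Pred (Fin n) 0ℓ} (P? : Decidable P) (f : Fin n → ℕ) → (∀ u → ¬ P u) → sumOver P? f ≡ 0
sumOver-empty P? f ¬P = sum-zero (λ u → restrict-no (P? u) (¬P u) (f u))

sumOver-singleton : {P : Pred (Fin n) 0ℓ} (P? : Decidable P) (f : Fin n → ℕ) →
  ∀ c → P c → (∀ u → P u → u ≡ c) → sumOver P? f ≡ f c
sumOver-singleton {suc n} P? f zero p !p =
  trans (cong₂ _+_ (restrict-yes (P? zero) p (f zero))
    (sumOver-empty (P? ∘ suc) (f ∘ suc) (λ u q → 0≢1+n (sym (!p (suc u) q))))) (+-identityʳ _)
sumOver-singleton {suc n} P? f (suc c) p !p =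
  cong₂ _+_ (restrict-no (P? zero) (λ q → 0≢1+n (!p zero q)) (f zero))
    (sumOver-singleton (P? ∘ suc) (f ∘ suc) c p (λ u q → suc-injective (!p (suc u) q)))

sumOver-⊎ : {P Q R : Pred (Fin n) 0ℓ} (P? : Decidable P) (Q? : Decidable Q) (R? : Decidable R) (f : Fin n → ℕ) →
  (∀ u → P u → Q u ⊎ R u) → (∀ u → Q u → P u × ¬ R u) → (∀ u → R u → P u) →
  sumOver P? f ≡ sumOver Q? f + sumOver R? f
sumOver-⊎ P? Q? R? f split Q⊆ R⊆ =
  trans (sum-cong-≗ (λ u → pointwise u (Q? u) (R? u)))
        (∑-distrib-+ (λ u → restrict (Q? u) (f u)) (λ u → restrict (R? u) (f u)))
  where
  pointwise : ∀ u (Q?u : Dec _) (R?u : Dec _) → restrict (P? u) (f u) ≡ restrict Q?u (f u) + restrict R?u (f u)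
  pointwise u (yes q) (yes r) = contradiction r (proj₂ (Q⊆ u q))
  pointwise u (yes q) (no _)  = trans (restrict-yes (P? u) (proj₁ (Q⊆ u q)) (f u)) (sym (+-identityʳ _))
  pointwise u (no _)  (yes r) = restrict-yes (P? u) (R⊆ u r) (f u)
  pointwise u (no ¬q) (no ¬r) = restrict-no (P? u) (λ p → [ ¬q , ¬r ] (split u p)) (f u)

count≡1⇒unique : {P : Pred (Fin n) 0ℓ} (P? : Decidable P) → count P? ≡ 1 → ∃[ c ] P c × (∀ u → P u → u ≡ c)
count≡1⇒unique P? eq with any? P?
... | no ∄      = contradiction (trans (sym (sumOver-empty P? _ (λ u p → ∄ (u , p)))) eq) λ ()
... | yes (c , p) = c , p , unique
  where
  unique : ∀ u → _ → u ≡ c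
  unique u q with u ≟ᶠ c
  ... | yes u≡c = u≡c
  ... | no u≢c  = contradiction
    (subst₂ _<_ (sumOver-singleton (_≟ᶠ c) (λ _ → 1) c refl (λ _ e → e)) eq
      (count-mono-< (_≟ᶠ c) P? (λ { _ refl → p }) u u≢c q)) (<-irrefl refl)

∣tabulate∣≡count : (f : Fin n → Bool) → ∣ tabulate f ∣ ≡ count (λ u → T? (f u))
∣tabulate∣≡count {zero}  f = refl
∣tabulate∣≡count {suc n} f with f zero
... | true  = cong suc (∣tabulate∣≡count (f ∘ suc))
... | false = ∣tabulate∣≡count (f ∘ suc)

degree≡count : (G : Graph n) → ∀ v → degree G v ≡ count (λ u → T? (adj G v u))
degree≡count G v = ∣tabulate∣≡count (adj G v)

count-all : ∀ n → count {n} (λ _ → yes tt) ≡ n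
count-all zero    = refl
count-all (suc n) = cong suc (count-all n)

count≡0⇒empty : ∀ {n} {P : Pred (Fin n) 0ℓ} (P? : Decidable P) → count P? ≡ 0 → ∀ u → ¬ P u
count≡0⇒empty P? eq u p = contradiction
  (subst₂ _≤_ (sumOver-singleton (_≟ᶠ u) (λ _ → 1) u refl (λ _ e → e)) eq
    (count-mono-≤ (_≟ᶠ u) P? (λ { _ refl → p }))) λ ()

-- If `y` were missed, punching it out would map `Fin (suc n)` injectively into `Fin n`.
injective⇒surjective : ∀ {n} {f : Fin n → Fin n} → Injective _≡_ _≡_ f → ∀ y → ∃[ x ] f x ≡ y
injective⇒surjective {suc n} {f} inj y with any? (λ x → f x ≟ᶠ y)
... | yes found = found
... | no missed = contradiction (injective⇒≤ {f = λ x → punchOut (y≢f x)}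
        (λ {u} {v} eq → inj (punchOut-injective (y≢f u) (y≢f v) eq))) 1+n≰n
  where
  y≢f : ∀ x → y ≢ f x
  y≢f x y≡fx = missed (x , sym y≡fx)

difference-cross : ∀ a b c d → + a ℤ.- + b ≡ + c ℤ.- + d → a + d ≡ c + b
difference-cross a b c d eq = ℤ.+-injective (begin
  + (a + d)                          ≡⟨ ℤ.pos-+ a d ⟩
  + a ℤ.+ + d                        ≡⟨ shift (+ a) (+ b) (+ d) ⟩
  (+ a ℤ.- + b) ℤ.+ (+ b ℤ.+ + d)    ≡⟨ cong₂ ℤ._+_ eq (ℤ.+-comm (+ b) (+ d)) ⟩
  (+ c ℤ.- + d) ℤ.+ (+ d ℤ.+ + b)    ≡⟨ shift (+ c) (+ d) (+ b) ⟨
  + c ℤ.+ + b                        ≡⟨ ℤ.pos-+ c b ⟨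
  + (c + b)                          ∎)
  where
  open ≡-Reasoning
  shift : ∀ x y z → x ℤ.+ z ≡ (x ℤ.- y) ℤ.+ (y ℤ.+ z)
  shift = solve-∀

-- Rooting a forest

module Rooting {n : ℕ} (G : Graph n) where

  adj? : ∀ u v → Dec (Adj G u v)
  adj? u v = T? (adj G u v)

  adj⇒≢ : ∀ {u v} → Adj G u v → u ≢ v
  adj⇒≢ uv refl = irreflexive G _ uv

  otherNeighbour : ∀ {v z} → degree G v ≡ 2 → Adj G v z →
    ∃[ x ] (Adj G v x × x ≢ z) × (∀ y → Adj G v y × y ≢ z → y ≡ x)
  otherNeighbour {v} {z} deg≡2 vz = count≡1⇒unique other? (ℕ.suc-injective eq)
    where
    other? : Decidable (λ x → Adj G v x × x ≢ z)
    other? x = adj? v x ×-dec ¬? (x ≟ᶠ z)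
    split : ∀ u → Adj G v u → u ≡ z ⊎ Adj G v u × u ≢ z
    split u vu with u ≟ᶠ z
    ... | yes u≡z = inj₁ u≡z
    ... | no u≢z  = inj₂ (vu , u≢z)
    eq : 1 + count other? ≡ 2
    eq = begin
      1 + count other?               ≡⟨ cong (_+ count other?) (sumOver-singleton (_≟ᶠ z) (λ _ → 1) z refl (λ _ e → e)) ⟨
      count (_≟ᶠ z) + count other?   ≡⟨ sumOver-⊎ (adj? v) (_≟ᶠ z) other? (λ _ → 1) split
                                          (λ { _ refl → vz , λ (_ , z≢z) → z≢z refl }) (λ _ → proj₁) ⟨
      count (adj? v)                 ≡⟨ degree≡count G v ⟨
      degree G v                     ≡⟨ deg≡2 ⟩
      2                              ∎
      where open ≡-Reasoning

  -- Listed from its most recent vertex 0 back to its start; values beyond len are junk.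
  record Path (R : Pred (Fin n) 0ℓ) (len : ℕ) : Set where
    field
      vertex   : ℕ → Fin n
      distinct : ∀ {i j} → i ≤ len → j ≤ len → vertex i ≡ vertex j → i ≡ j
      step     : ∀ {i} → i < len → Adj G (vertex i) (vertex (suc i))
      end∈     : R (vertex 0)

  module _ {R : Pred (Fin n) 0ℓ}
           (next : ∀ v → R v → ∀ x → ∃[ z ] R z × Adj G v z × z ≢ x)
           (forest : IsForest G) where

    -- In a forest the new vertex `z` lies off the path: it differs from vertex 0 by adjacency, from
    -- vertex 1 by choice, and meeting a later vertex would close a cycle.
    extend : ∀ {len} → Path R len → Path R (suc len)
    -- For `len = 0` the vertex 1 to be avoided is junk, which does no harm.
    extend {len} p with z , Rz , az , z≢ ← next (Path.vertex p 0) (Path.end∈ p) (Path.vertex p 1) = extended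
      where
      open Path p
      fresh : ∀ i → i ≤ len → z ≢ vertex i
      fresh 0 _ z≡ = adj⇒≢ az (sym z≡)
      fresh 1 _ z≡ = z≢ z≡
      fresh (suc (suc k)) i≤ z≡ = forest record
        { k        = k
        ; vertex   = vertex ∘ toℕ
        ; distinct = λ {i} {j} eq → toℕ-injective (distinct (bound i) (bound j) eq)
        ; step     = λ i → subst (λ m → Adj G (vertex m) (vertex (suc (toℕ i)))) (sym (toℕ-inject₁ i))
                       (step (≤-trans (toℕ<n i) i≤))
        ; close    = subst (λ x → Adj G x (vertex 0)) (trans z≡ (cong vertex (sym (toℕ-fromℕ (2 + k)))))
                       (symmetric G az)
        }
        where
        bound : (i : Fin (3 + k)) → toℕ i ≤ len
        bound i = ≤-trans (s≤s⁻¹ (toℕ<n i)) i≤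
      vertex′ : ℕ → Fin n
      vertex′ zero    = z
      vertex′ (suc i) = vertex i
      distinct′ : ∀ {i j} → i ≤ suc len → j ≤ suc len → vertex′ i ≡ vertex′ j → i ≡ j
      distinct′ {zero}  {zero}  _ _ _ = refl
      distinct′ {zero}  {suc j} _ (s≤s j≤) eq = contradiction eq (fresh j j≤)
      distinct′ {suc i} {zero}  (s≤s i≤) _ eq = contradiction (sym eq) (fresh i i≤)
      distinct′ {suc i} {suc j} (s≤s i≤) (s≤s j≤) eq = cong suc (distinct i≤ j≤ eq)
      step′ : ∀ {i} → i < suc len → Adj G (vertex′ i) (vertex′ (suc i))
      step′ {zero}  _        = symmetric G az
      step′ {suc i} (s≤s i<) = step i<
      extended : Path R (suc len)
      extended = record { vertex = vertex′ ; distinct = distinct′ ; step = step′ ; end∈ = Rz }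

    longPath : ∀ v → R v → ∀ len → Path R len
    longPath v Rv zero = record
      { vertex = λ _ → v ; distinct = λ { z≤n z≤n _ → refl } ; step = λ () ; end∈ = Rv }
    longPath v Rv (suc len) = extend (longPath v Rv len)

    -- A path with n + 1 distinct vertices does not fit into n vertices.
    forest⇒¬next : ∀ v → ¬ R v
    forest⇒¬next v Rv = <-irrefl refl (injective⇒≤ {f = vertex ∘ toℕ}
      (λ {i} {j} eq → toℕ-injective (distinct (s≤s⁻¹ (toℕ<n i)) (s≤s⁻¹ (toℕ<n j)) eq)))
      where open Path (longPath v Rv n)

  -- The witness `x` need not be a neighbour of `v`, which also covers the case of no neighbour.
  AtMostOneNeighbourIn : Pred (Fin n) 0ℓ → Fin n → Set
  AtMostOneNeighbourIn R v = ∃[ x ] ∀ z → R z → Adj G v z → z ≡ x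

  -- If every vertex in `R` had two neighbours in `R`, paths within `R` could be prolonged without
  -- end.
  forest⇒sparse : IsForest G → {R : Pred (Fin n) 0ℓ} → Decidable R →
    ∀ u → R u → ∃[ v ] R v × AtMostOneNeighbourIn R v
  forest⇒sparse forest {R} R? u Ru
    with any? (λ v → R? v ×-dec any? (λ x → all? (λ z → R? z →-dec (adj? v z →-dec (z ≟ᶠ x)))))
  ... | yes sparse = sparse
  ... | no ∄ = contradiction Ru (forest⇒¬next next forest u)
    where
    next : ∀ v → R v → ∀ x → ∃[ z ] R z × Adj G v z × z ≢ x
    next v Rv x with any? (λ z → R? z ×-dec (adj? v z ×-dec ¬? (z ≟ᶠ x)))
    ... | yes found = found
    ... | no none = contradiction
      (v , Rv , x , λ z Rz vz → decidable-stable (z ≟ᶠ x) (λ z≢x → none (z , Rz , vz , z≢x))) ∄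

  -- position v counts down as vertices are deleted, so the earlier neighbour of a vertex,
  -- its parent, is the one neighbour left when the vertex is deleted.
  record Elimination (R : Pred (Fin n) 0ℓ) (k : ℕ) : Set where
    field
      position : Fin n → ℕ
      bounded  : ∀ {v} → R v → position v < k
      distinct : ∀ {u v} → R u → R v → Adj G u v → position u ≢ position v
      unique   : ∀ {v a b} → R v → R a → R b → Adj G v a → Adj G v b →
                 position a < position v → position b < position v → a ≡ b
      root     : ∀ {v} → R v → (∀ a → R a → Adj G v a → ¬ (position a < position v)) → degree G v ≢ 2

  module _ {R : Pred (Fin n) 0ℓ} {k : ℕ} (v : Fin n) (sparse-v : AtMostOneNeighbourIn R v)
           (v-hasParent : degree G v ≡ 2 → ∃[ y ] R y × Adj G v y)
           (rest : Elimination (λ u → R u × u ≢ v) k) where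

    private
      open Elimination rest
      sparse : ∀ z → R z → Adj G v z → z ≡ proj₁ sparse-v
      sparse = proj₂ sparse-v

      -- Deleted first, `v` takes the top position `k`; so all its neighbours in `R` are earlier,
      -- and `v` is the parent of none of them.
      pos : Fin n → ℕ
      pos u = if does (u ≟ᶠ v) then k else position u
      pos-v : pos v ≡ k
      pos-v rewrite dec-true (v ≟ᶠ v) refl = refl
      pos-≢ : ∀ {u} → u ≢ v → pos u ≡ position u
      pos-≢ {u} u≢v rewrite dec-false (u ≟ᶠ v) u≢v = refl

      pos<k : ∀ {u} → R u → u ≢ v → pos u < k
      pos<k Ru u≢v = subst (_< k) (sym (pos-≢ u≢v)) (bounded (Ru , u≢v))

      bounded′ : ∀ {u} → R u → pos u < suc k
      bounded′ {u} Ru with u ≟ᶠ v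
      ... | yes refl = ≤-refl
      ... | no u≢v = m<n⇒m<1+n (bounded (Ru , u≢v))

      distinct′ : ∀ {a b} → R a → R b → Adj G a b → pos a ≢ pos b
      distinct′ {a} {b} Ra Rb ab eq with a ≟ᶠ v | b ≟ᶠ v
      ... | yes refl | yes refl = adj⇒≢ ab refl
      ... | yes refl | no b≢v = <⇒≢ (bounded (Rb , b≢v)) (sym eq)
      ... | no a≢v | yes refl = <⇒≢ (bounded (Ra , a≢v)) eq
      ... | no a≢v | no b≢v = distinct (Ra , a≢v) (Rb , b≢v) ab eq

      earlier≢v : ∀ {a u} → R u → u ≢ v → pos a < pos u → a ≢ v
      earlier≢v Ru u≢v a<u refl = <-asym (pos<k Ru u≢v) (subst (_< pos _) pos-v a<u)

      unique′ : ∀ {u a b} → R u → R a → R b → Adj G u a → Adj G u b → pos a < pos u → pos b < pos u → a ≡ b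
      unique′ {u} {a} {b} Ru Ra Rb ua ub a<u b<u with u ≟ᶠ v
      ... | yes refl = trans (sparse a Ra ua) (sym (sparse b Rb ub))
      ... | no u≢v = unique (Ru , u≢v) (Ra , a≢v) (Rb , b≢v) ua ub
              (subst₂ _<_ (pos-≢ a≢v) refl a<u) (subst₂ _<_ (pos-≢ b≢v) refl b<u)
        where
        a≢v : a ≢ v
        a≢v = earlier≢v Ru u≢v (subst (pos a <_) (sym (pos-≢ u≢v)) a<u)
        b≢v : b ≢ v
        b≢v = earlier≢v Ru u≢v (subst (pos b <_) (sym (pos-≢ u≢v)) b<u)

      root′ : ∀ {u} → R u → (∀ a → R a → Adj G u a → ¬ (pos a < pos u)) → degree G u ≢ 2
      root′ {u} Ru noParent = go (u ≟ᶠ v)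
        where
        go : Dec (u ≡ v) → degree G u ≢ 2
        go (no u≢v) = root (Ru , u≢v) (λ a (Ra , a≢v) ua a<u →
          noParent a Ra ua (subst₂ _<_ (sym (pos-≢ a≢v)) (sym (pos-≢ u≢v)) a<u))
        go (yes refl) deg≡2 with y , Ry , uy ← v-hasParent deg≡2 =
          noParent y Ry uy (subst (pos y <_) (sym pos-v) (pos<k Ry (λ { refl → adj⇒≢ uy refl })))

    deleteFirst : Elimination R (suc k)
    deleteFirst = record
      { position = pos
      ; bounded  = bounded′
      ; distinct = distinct′
      ; unique   = unique′
      ; root     = root′
      }

  -- Only vertices of degree 2 must keep a parent, so a vertex of another degree counts as full
  -- whatever has been deleted.
  Full : Pred (Fin n) 0ℓ → Fin n → Set
  Full R u = degree G u ≡ 2 → ∀ z → Adj G u z → R z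

  -- Deleting the only vertex that is not full, if there is one, again leaves at most one such
  -- vertex, which still has a neighbour; so no vertex of degree 2 is the last of its component.
  eliminate : IsForest G → ∀ k {R : Pred (Fin n) 0ℓ} (R? : Decidable R) → count R? ≤ k →
    (∀ u → R u → degree G u ≡ 2 → ∃[ y ] R y × Adj G u y) →
    (∀ u u′ → R u → R u′ → ¬ Full R u → ¬ Full R u′ → u ≡ u′) →
    Elimination R k
  eliminate forest k {R} R? size noBadRoot oneDeficient with any? R?
  ... | no ∄ = record
    { position = λ _ → 0
    ; bounded  = λ Rv → contradiction (_ , Rv) ∄
    ; distinct = λ Ru → contradiction (_ , Ru) ∄
    ; unique   = λ Rv → contradiction (_ , Rv) ∄
    ; root     = λ Rv → contradiction (_ , Rv) ∄
    }
  eliminate forest zero {R} R? size noBadRoot oneDeficient | yes (v , Rv) =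
    contradiction (≤-trans (count-mono-< {P = λ _ → ⊥} (λ _ → no λ ()) R? (λ _ ()) v (λ ()) Rv) size) λ ()
  eliminate forest (suc k) {R} R? size noBadRoot oneDeficient | yes (v₀ , Rv₀) =
    delete choice
    where
    full? : ∀ u → Dec (Full R u)
    full? u = (degree G u ≟ 2) →-dec all? (λ z → adj? u z →-dec R? z)

    Deletable : Fin n → Set
    Deletable v = R v × AtMostOneNeighbourIn R v × (∀ u → R u → u ≢ v → Full R u)

    choice : ∃[ v ] Deletable v
    choice with any? (λ u → R? u ×-dec ¬? (full? u))
    ... | no allFull with v , Rv , sparse ← forest⇒sparse forest R? v₀ Rv₀ =
      v , Rv , sparse , λ u Ru _ → decidable-stable (full? u) (λ ¬full → allFull (u , Ru , ¬full))
    -- The deficient vertex must go now, before it loses its second neighbour too. Having lost one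
    -- of its two neighbours, it is sparse.
    ... | yes (v , Rv , ¬full) = v , Rv , sparse , λ u Ru u≢v →
            decidable-stable (full? u) (λ ¬full′ → u≢v (oneDeficient u v Ru Rv ¬full′ ¬full))
      where
      sparse : AtMostOneNeighbourIn R v
      sparse with degree G v ≟ 2 | any? (λ z → adj? v z ×-dec ¬? (R? z))
      ... | no deg≢2  | _ = contradiction (λ deg≡2 → contradiction deg≡2 deg≢2) ¬full
      ... | yes _     | no ∄ = contradiction
            (λ _ z vz → decidable-stable (R? z) (λ ¬Rz → ∄ (z , vz , ¬Rz))) ¬full
      ... | yes deg≡2 | yes (z , vz , ¬Rz) with x , _ , only ← otherNeighbour deg≡2 vz =
            x , λ y Ry vy → only y (vy , λ { refl → ¬Rz Ry })

    delete : ∃[ v ] Deletable v → Elimination R (suc k)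
    delete (v , Rv , sparse@(x , onlyx) , full) = deleteFirst v sparse (noBadRoot v Rv)
      (eliminate forest k R′?
        (s≤s⁻¹ (≤-trans (count-mono-< R′? R? (λ _ → proj₁) v (λ (_ , v≢v) → v≢v refl) Rv) size))
        noBadRoot′ oneDeficient′)
      where
      R′ : Pred (Fin n) 0ℓ
      R′ u = R u × u ≢ v
      R′? : Decidable R′
      R′? u = R? u ×-dec ¬? (u ≟ᶠ v)

      noBadRoot′ : ∀ u → R′ u → degree G u ≡ 2 → ∃[ y ] R′ y × Adj G u y
      noBadRoot′ u (Ru , u≢v) deg≡2 with y , Ry , uy ← noBadRoot u Ru deg≡2 with y ≟ᶠ v
      ... | no y≢v = y , (Ry , y≢v) , uy
      -- The other neighbour of `u` remains, as `u` was full before `v` was deleted.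
      ... | yes refl with y′ , (uy′ , y′≢v) , _ ← otherNeighbour deg≡2 uy =
            y′ , (full u Ru u≢v deg≡2 y′ uy′ , y′≢v) , uy′

      deficient⇒adj : ∀ u → R′ u → ¬ Full R′ u → Adj G u v
      deficient⇒adj u (Ru , u≢v) ¬full = decidable-stable (adj? u v) λ ¬uv →
        ¬full λ deg≡2 z uz → full u Ru u≢v deg≡2 z uz , λ { refl → ¬uv uz }

      -- Newly deficient vertices are neighbours of `v`, and `v` has at most one neighbour in `R`.
      oneDeficient′ : ∀ u u′ → R′ u → R′ u′ → ¬ Full R′ u → ¬ Full R′ u′ → u ≡ u′
      oneDeficient′ u u′ Ru Ru′ ¬full ¬full′ = trans
        (onlyx u (proj₁ Ru) (symmetric G (deficient⇒adj u Ru ¬full)))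
        (sym (onlyx u′ (proj₁ Ru′) (symmetric G (deficient⇒adj u′ Ru′ ¬full′))))

-- The order of the edges

module KeyOrder where

  -- Keys are formal lexicographic data containing the key of the edge above, so that the order can
  -- refer to itself one edge nearer to the root before any labels are assigned.
  data Key : Set where
    root : ℕ → Key
    edge : (kind children : ℕ) (parent : Key) (index : ℕ) → Key

  private
    variable
      s s′ d d′ i i′ : ℕ
      κ κ′ : Key

  infix 4 _≺_

  data _≺_ : Key → Key → Set where
    root<root : i < i′ → root i ≺ root i′
    root<edge : root i ≺ edge s d κ i′
    by-kind   : s < s′ → edge s d κ i ≺ edge s′ d′ κ′ i′
    by-degree : d < d′ → edge s d κ i ≺ edge s d′ κ′ i′
    by-parent : s ≢ 1 → κ ≺ κ′ → edge s d κ i ≺ edge s d κ′ i′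
    -- Kind 1 is that of the edges below lower vertices.
    reversed  : κ′ ≺ κ → edge 1 d κ i ≺ edge 1 d κ′ i′
    by-index  : i < i′ → edge s d κ i ≺ edge s d κ i′

  ≺-irrefl : ¬ (κ ≺ κ)
  ≺-irrefl (root<root p)   = <-irrefl refl p
  ≺-irrefl (by-kind p)     = <-irrefl refl p
  ≺-irrefl (by-degree p)   = <-irrefl refl p
  ≺-irrefl (by-parent _ p) = ≺-irrefl p
  ≺-irrefl (reversed p)    = ≺-irrefl p
  ≺-irrefl (by-index p)    = <-irrefl refl p

  ≺-trans : ∀ {a b c} → a ≺ b → b ≺ c → a ≺ c
  ≺-trans (root<root p)   (root<root q)   = root<root (<-trans p q)
  ≺-trans (root<root _)   root<edge       = root<edge
  ≺-trans {c = edge _ _ _ _} root<edge _  = root<edge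
  ≺-trans (by-kind p)     (by-kind q)     = by-kind (<-trans p q)
  ≺-trans (by-kind p)     (by-degree _)   = by-kind p
  ≺-trans (by-kind p)     (by-parent _ _) = by-kind p
  ≺-trans (by-kind p)     (reversed _)    = by-kind p
  ≺-trans (by-kind p)     (by-index _)    = by-kind p
  ≺-trans (by-degree _)   (by-kind q)     = by-kind q
  ≺-trans (by-degree p)   (by-degree q)   = by-degree (<-trans p q)
  ≺-trans (by-degree p)   (by-parent _ _) = by-degree p
  ≺-trans (by-degree p)   (reversed _)    = by-degree p
  ≺-trans (by-degree p)   (by-index _)    = by-degree p
  ≺-trans (by-parent _ _) (by-kind q)     = by-kind q
  ≺-trans (by-parent _ _) (by-degree q)   = by-degree q
  ≺-trans (by-parent r p) (by-parent _ q) = by-parent r (≺-trans p q)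
  ≺-trans (by-parent r _) (reversed _)    = contradiction refl r
  ≺-trans (by-parent r p) (by-index _)    = by-parent r p
  ≺-trans (reversed _)    (by-kind q)     = by-kind q
  ≺-trans (reversed _)    (by-degree q)   = by-degree q
  ≺-trans (reversed _)    (by-parent r _) = contradiction refl r
  ≺-trans (reversed p)    (reversed q)    = reversed (≺-trans q p)
  ≺-trans (reversed p)    (by-index _)    = reversed p
  ≺-trans (by-index _)    (by-kind q)     = by-kind q
  ≺-trans (by-index _)    (by-degree q)   = by-degree q
  ≺-trans (by-index _)    (by-parent r q) = by-parent r q
  ≺-trans (by-index _)    (reversed q)    = reversed q
  ≺-trans (by-index p)    (by-index q)    = by-index (<-trans p q)

  ≺-compare : ∀ a b → a ≺ b ⊎ a ≡ b ⊎ b ≺ a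
  ≺-compare (root i) (root j) with <-cmp i j
  ... | tri< i<j _ _  = inj₁ (root<root i<j)
  ... | tri≈ _ refl _ = inj₂ (inj₁ refl)
  ... | tri> _ _ j<i  = inj₂ (inj₂ (root<root j<i))
  ≺-compare (root _) (edge _ _ _ _) = inj₁ root<edge
  ≺-compare (edge _ _ _ _) (root _) = inj₂ (inj₂ root<edge)
  ≺-compare (edge s d κ i) (edge s′ d′ κ′ i′) with <-cmp s s′
  ... | tri< s<s′ _ _ = inj₁ (by-kind s<s′)
  ... | tri> _ _ s′<s = inj₂ (inj₂ (by-kind s′<s))
  ... | tri≈ _ refl _ with <-cmp d d′
  ... | tri< d<d′ _ _ = inj₁ (by-degree d<d′)
  ... | tri> _ _ d′<d = inj₂ (inj₂ (by-degree d′<d))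
  ... | tri≈ _ refl _ with ≺-compare κ κ′ | s ≟ 1
  ... | inj₁ κ≺κ′        | yes refl = inj₂ (inj₂ (reversed κ≺κ′))
  ... | inj₁ κ≺κ′        | no s≢1   = inj₁ (by-parent s≢1 κ≺κ′)
  ... | inj₂ (inj₂ κ′≺κ) | yes refl = inj₁ (reversed κ′≺κ)
  ... | inj₂ (inj₂ κ′≺κ) | no s≢1   = inj₂ (inj₂ (by-parent s≢1 κ′≺κ))
  ... | inj₂ (inj₁ refl) | _ with <-cmp i i′
  ... | tri< i<i′ _ _ = inj₁ (by-index i<i′)
  ... | tri≈ _ refl _ = inj₂ (inj₁ refl)
  ... | tri> _ _ i′<i = inj₂ (inj₂ (by-index i′<i))

  _≺?_ : ∀ a b → Dec (a ≺ b)
  a ≺? b with ≺-compare a b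
  ... | inj₁ a≺b         = yes a≺b
  ... | inj₂ (inj₁ refl) = no ≺-irrefl
  ... | inj₂ (inj₂ b≺a)  = no λ a≺b → ≺-irrefl (≺-trans a≺b b≺a)

open KeyOrder

-- Roles and labels

-- The vertices other than hubs form the interiors of paths with one or two inner vertices
-- joining a hub to a hub further from the root: upper is the inner vertex next to the hub
-- nearer to the root, and lower the second inner vertex if there is one.
data Role : Set where
  upper lower hub : Role

-- The level is at once the kind in the keys and the rule of orientation: each edge points to its
-- end of higher level.
level : Role → ℕ
level upper = 0
level lower = 1
level hub   = 2

-- The flag tells whether a second inner vertex is wanted, a question that arises only below an
-- `upper` vertex.
childRole : Bool → Role → Role
childRole _     hub   = upper
childRole true  upper = lower
childRole false upper = hub
childRole _     lower = hub

module Labelling {n : ℕ} (F : Graph n)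
  (elimination : Rooting.Elimination F (λ _ → ⊤) n)
  (independent : Independent F (λ v → degree F v ≢ 2))
  where

  open Rooting F
  open Elimination elimination renaming (unique to position-unique; root to position-root; distinct to position-distinct)

  -- Parents and recursion from the roots

  Parent : Fin n → Fin n → Set
  Parent v p = Adj F v p × position p < position v

  parent? : ∀ v p → Dec (Parent v p)
  parent? v p = adj? v p ×-dec (position p <? position v)

  HasParent : Fin n → Set
  HasParent v = ∃[ p ] Parent v p

  hasParent? : ∀ v → Dec (HasParent v)
  hasParent? v = any? (parent? v)

  parent-unique : ∀ {v p q} → Parent v p → Parent v q → p ≡ q
  parent-unique (vp , p<v) (vq , q<v) = position-unique tt tt tt vp vq p<v q<v

  parent-asym : ∀ {u v} → Parent u v → ¬ Parent v u
  parent-asym (_ , v<u) (_ , u<v) = <-asym v<u u<v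

  adj⇒parent : ∀ {u v} → Adj F u v → Parent u v ⊎ Parent v u
  adj⇒parent {u} {v} uv with <-cmp (position u) (position v)
  ... | tri< u<v _ _ = inj₂ (symmetric F uv , u<v)
  ... | tri≈ _ u≡v _ = contradiction u≡v (position-distinct tt tt uv)
  ... | tri> _ _ v<u = inj₁ (uv , v<u)

  root⇒degree≢2 : ∀ {v} → ¬ HasParent v → degree F v ≢ 2
  root⇒degree≢2 isRoot = position-root tt (λ a _ va a<v → isRoot (a , va , a<v))

  onlyChild : ∀ {v p} → degree F v ≡ 2 → Parent v p → ∃[ c ] Parent c v × (∀ u → Parent u v → u ≡ c)
  onlyChild {v} {p} deg≡2 vp@(v~p , _) with c , (vc , c≢p) , only ← otherNeighbour deg≡2 v~p with adj⇒parent vc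
  ... | inj₁ pc = contradiction (parent-unique pc vp) c≢p
  ... | inj₂ cv = c , cv , λ u uv → only u (symmetric F (proj₁ uv) , λ { refl → parent-asym vp uv })

  -- Recursion along the parent relation, run with fuel. `abstract` hides the fuel and leaves two
  -- equations to reason with.
  module TopDown {A : Set} (base : Fin n → A) (step : Fin n → Fin n → A → A) where

    private
      visit : ∀ v → Dec (HasParent v) → (Fin n → A) → A
      visit v (no _)        f = base v
      visit v (yes (p , _)) f = step v p (f p)

      approx : ℕ → Fin n → A
      approx zero    v = base v
      approx (suc k) v = visit v (hasParent? v) (approx k)

      -- Positions decrease towards the root, so fuel above the position of `v` never runs out.
      stable : ∀ k l v → position v < k → position v < l → approx k v ≡ approx l v
      stable (suc k) (suc l) v (s≤s v≤k) (s≤s v≤l) with hasParent? v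
      ... | no _ = refl
      ... | yes (p , _ , p<v) = cong (step v p) (stable k l p (<-≤-trans p<v v≤k) (<-≤-trans p<v v≤l))

    abstract
      solution : Fin n → A
      solution v = approx (suc (position v)) v

      solution-root : ∀ v → ¬ HasParent v → solution v ≡ base v
      solution-root v isRoot with hasParent? v
      ... | no _   = refl
      ... | yes vp = contradiction vp isRoot

      solution-child : ∀ {v p} → Parent v p → solution v ≡ step v p (solution p)
      solution-child {v} {p} vp with hasParent? v
      ... | no isRoot = contradiction (p , vp) isRoot
      ... | yes (q , vq) with refl ← parent-unique vp vq =
        cong (step v p) (stable (position v) (suc (position p)) p (proj₂ vp) ≤-refl)

  -- Consider a vertex `v` of degree 2 below an `upper` vertex. As a hub it would make its child
  -- `upper`; a child of degree other than 2 must be a hub instead, so `v` becomes `lower`.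
  EndsLink : Fin n → Set
  EndsLink v = degree F v ≡ 2 × (∃[ c ] Parent c v × degree F c ≢ 2)

  endsLink? : ∀ v → Dec (EndsLink v)
  endsLink? v = (degree F v ≟ 2) ×-dec any? (λ c → parent? c v ×-dec ¬? (degree F c ≟ 2))

  private
    module R = TopDown (λ _ → hub) (λ v _ → childRole (does (endsLink? v)))

  role : Fin n → Role
  role = R.solution

  role-root : ∀ v → ¬ HasParent v → role v ≡ hub
  role-root = R.solution-root

  role-below-hub : ∀ {v p} → Parent v p → role p ≡ hub → role v ≡ upper
  role-below-hub vp p≡hub = trans (R.solution-child vp) (cong (childRole _) p≡hub)

  role-below-lower : ∀ {v p} → Parent v p → role p ≡ lower → role v ≡ hub
  role-below-lower vp p≡lower = trans (R.solution-child vp) (cong (childRole _) p≡lower)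

  role-below-upper : ∀ {v p} → Parent v p → role p ≡ upper →
    (role v ≡ lower × EndsLink v) ⊎ (role v ≡ hub × ¬ EndsLink v)
  role-below-upper {v} vp p≡upper = decide (endsLink? v) (trans (R.solution-child vp) (cong (childRole _) p≡upper))
    where
    decide : (ends? : Dec (EndsLink v)) → role v ≡ childRole (does ends?) upper →
      (role v ≡ lower × EndsLink v) ⊎ (role v ≡ hub × ¬ EndsLink v)
    decide (yes ends) eq = inj₁ (eq , ends)
    decide (no ¬ends) eq = inj₂ (eq , ¬ends)

  -- Degrees along the links between hubs

  data Position (v : Fin n) : Set where
    isRoot      : role v ≡ hub → ¬ HasParent v → Position v
    below-hub   : ∀ {p} → Parent v p → role p ≡ hub → role v ≡ upper → Position v
    below-upper : ∀ {p} → Parent v p → role p ≡ upper → role v ≡ hub → ¬ EndsLink v → Position v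
    ends-link   : ∀ {p} → Parent v p → role p ≡ upper → role v ≡ lower → EndsLink v → Position v
    below-lower : ∀ {p} → Parent v p → role p ≡ lower → role v ≡ hub → Position v

  whereIs : ∀ v → Position v
  whereIs v with hasParent? v
  ... | no ∄ = isRoot (role-root v ∄) ∄
  ... | yes (p , vp) with role p in eq
  ... | hub   = below-hub vp eq (role-below-hub vp eq)
  ... | lower = below-lower vp eq (role-below-lower vp eq)
  ... | upper with role-below-upper vp eq
  ... | inj₁ (v≡lower , ends) = ends-link vp eq v≡lower ends
  ... | inj₂ (v≡hub , ¬ends)  = below-upper vp eq v≡hub ¬ends

  -- Roots and hubs below `lower` vertices have degree other than 2, so independence applies. A hub
  -- below an `upper` vertex has such a degree too, or it fails to be `EndsLink` because all its
  -- children have degree 2.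
  hub-child-degree : ∀ {v c} → role v ≡ hub → Parent c v → degree F c ≡ 2
  hub-child-degree {v} {c} v≡hub cv = decidable-stable (degree F c ≟ 2) (go (whereIs v))
    where
    go : Position v → ¬ (degree F c ≢ 2)
    go (isRoot _ ∄) c≢2 = independent c v c≢2 (root⇒degree≢2 ∄) (proj₁ cv)
    go (below-hub _ _ v≡upper) = contradiction (trans (sym v≡hub) v≡upper) λ ()
    go (ends-link _ _ v≡lower _) = contradiction (trans (sym v≡hub) v≡lower) λ ()
    go (below-upper _ _ _ ¬ends) c≢2 with degree F v ≟ 2
    ... | yes v≡2 = ¬ends (v≡2 , c , cv , c≢2)
    ... | no v≢2  = independent c v c≢2 v≢2 (proj₁ cv)
    go (below-lower {p} vp p≡lower _) c≢2 with whereIs p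
    ... | isRoot eq _ = contradiction (trans (sym p≡lower) eq) λ ()
    ... | below-hub _ _ eq = contradiction (trans (sym p≡lower) eq) λ ()
    ... | below-upper _ _ eq _ = contradiction (trans (sym p≡lower) eq) λ ()
    ... | below-lower _ _ eq = contradiction (trans (sym p≡lower) eq) λ ()
    -- The one child of `p` is `v`, so the child of degree other than 2 that made `p` end a link is
    -- `v` itself.
    ... | ends-link pq _ _ (p≡2 , v′ , v′p , v′≢2)
        with _ , _ , only ← onlyChild p≡2 pq
        with refl ← trans (only v vp) (sym (only v′ v′p)) = independent c v c≢2 v′≢2 (proj₁ cv)

  record Inner (v : Fin n) : Set where
    field
      {parent}  : Fin n
      hasParent : Parent v parent
      child     : Fin n
      hasChild  : Parent child v
      unique    : ∀ u → Parent u v → u ≡ child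

  inner : ∀ {v} → role v ≢ hub → Inner v
  inner {v} v≢hub = go (whereIs v)
    where
    build : ∀ {p} → Parent v p → degree F v ≡ 2 → Inner v
    build vp v≡2 with c , cv , only ← onlyChild v≡2 vp =
      record { hasParent = vp ; child = c ; hasChild = cv ; unique = only }
    go : Position v → Inner v
    go (isRoot v≡hub _) = contradiction v≡hub v≢hub
    go (below-hub vp p≡hub _) = build vp (hub-child-degree p≡hub vp)
    go (below-upper _ _ v≡hub _) = contradiction v≡hub v≢hub
    go (ends-link vp _ _ (v≡2 , _)) = build vp v≡2
    go (below-lower _ _ v≡hub) = contradiction v≡hub v≢hub

  -- Keys, ranks and labels of the edges

  childCount : Fin n → ℕ
  childCount v = count (λ u → parent? u v)

  private
    -- The successor leaves the index 0 for a key below those of all children of `p`.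
    module K = TopDown (root ∘ toℕ) (λ v p κ → edge (level (role p)) (childCount p) κ (suc (toℕ v)))

  -- The key of a vertex also serves as the key of the edge to its parent.
  key : Fin n → Key
  key = K.solution

  key-root : ∀ v → ¬ HasParent v → key v ≡ root (toℕ v)
  key-root = K.solution-root

  key-child : ∀ {v p r} → Parent v p → role p ≡ r → key v ≡ edge (level r) (childCount p) (key p) (suc (toℕ v))
  key-child vp refl = K.solution-child vp

  key-injective : ∀ {u v} → key u ≡ key v → u ≡ v
  key-injective {u} {v} eq with hasParent? u | hasParent? v
  ... | no ∄u | no ∄v with eq′ ← trans (sym (key-root u ∄u)) (trans eq (key-root v ∄v)) =
    toℕ-injective (root-injective eq′)
    where
    root-injective : ∀ {i j} → root i ≡ root j → i ≡ j
    root-injective refl = refl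
  ... | no ∄u | yes (_ , vp) = contradiction (trans (sym (key-root u ∄u)) (trans eq (key-child vp refl))) λ ()
  ... | yes (_ , up) | no ∄v = contradiction (trans (sym (key-child up refl)) (trans eq (key-root v ∄v))) λ ()
  ... | yes (_ , up) | yes (_ , vq) =
    toℕ-injective (index-injective (trans (sym (key-child up refl)) (trans eq (key-child vq refl))))
    where
    index-injective : ∀ {s d κ i s′ d′ κ′ i′} → edge s d κ (suc i) ≡ edge s′ d′ κ′ (suc i′) → i ≡ i′
    index-injective refl = refl

  ≺-total : ∀ {u v} → u ≢ v → key u ≺ key v ⊎ key v ≺ key u
  ≺-total {u} {v} u≢v with ≺-compare (key u) (key v)
  ... | inj₁ u≺v        = inj₁ u≺v
  ... | inj₂ (inj₁ eq)  = contradiction (key-injective eq) u≢v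
  ... | inj₂ (inj₂ v≺u) = inj₂ v≺u

  below? : ∀ κ → Decidable (λ u → key u ≺ κ)
  below? κ u = key u ≺? κ

  root? : ∀ v → Dec (¬ HasParent v)
  root? v = ¬? (hasParent? v)

  abstract
    -- Defined on all keys, not only on those of vertices, so that it also ranks thresholds between
    -- labels.
    rank : Key → ℕ
    rank κ = count (below? κ)

    roots : ℕ
    roots = count root?

    rank-mono-≤ : ∀ {κ κ′} → κ ≺ κ′ → rank κ ≤ rank κ′
    rank-mono-≤ {κ} {κ′} κ≺κ′ = count-mono-≤ (below? κ) (below? κ′) (λ _ u≺κ → ≺-trans u≺κ κ≺κ′)

    rank-mono-< : ∀ {u κ} → key u ≺ κ → rank (key u) < rank κ
    rank-mono-< {u} {κ} u≺κ =
      count-mono-< (below? (key u)) (below? κ) (λ _ v≺u → ≺-trans v≺u u≺κ) u ≺-irrefl u≺κ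

    -- Keys of roots precede all others, so the roots take up the ranks below `roots` and leave the
    -- ranks from `roots` to n - 1 to the edges.
    roots≤rank : ∀ {s d κ i} → roots ≤ rank (edge s d κ i)
    roots≤rank {s} {d} {κ} {i} = count-mono-≤ root? (below? (edge s d κ i))
      (λ u ∄ → subst (_≺ edge s d κ i) (sym (key-root u ∄)) root<edge)

    rank-root<roots : ∀ {v} → ¬ HasParent v → rank (key v) < roots
    rank-root<roots {v} ∄ = count-mono-< (below? (key v)) root? below-root v ≺-irrefl ∄
      where
      below-root : ∀ u → key u ≺ key v → ¬ HasParent u
      below-root u u≺v (_ , up) with () ← subst₂ _≺_ (key-child up refl) (key-root v ∄) u≺v

    rank<n : ∀ v → rank (key v) < n
    rank<n v = subst (rank (key v) <_) (count-all n)
      (count-mono-< (below? (key v)) (λ _ → yes tt) (λ _ _ → tt) v ≺-irrefl tt)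

    roots≤n : roots ≤ n
    roots≤n = subst (roots ≤_) (count-all n) (count-mono-≤ root? (λ _ → yes tt) (λ _ _ → tt))

  roots≤rank-child : ∀ {v p} → Parent v p → roots ≤ rank (key v)
  roots≤rank-child vp = subst (λ κ → roots ≤ rank κ) (sym (key-child vp refl)) roots≤rank

  -- Truncated subtraction: roots get 0, and the other vertices 1, 2, ….
  label : Fin n → ℕ
  label v = suc (rank (key v)) ∸ roots

  label-root : ∀ {v} → ¬ HasParent v → label v ≡ 0
  label-root ∄ = m≤n⇒m∸n≡0 (rank-root<roots ∄)

  label-child : ∀ {v p} → Parent v p → label v ≡ suc (rank (key v) ∸ roots)
  label-child vp = +-∸-assoc 1 (roots≤rank-child vp)

  label-mono-≤ : ∀ {u v} → key u ≺ key v → label u ≤ label v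
  label-mono-≤ u≺v = ∸-monoˡ-≤ roots (s≤s (rank-mono-≤ u≺v))

  label-mono-< : ∀ {u v p} → Parent v p → key u ≺ key v → label u < label v
  label-mono-< {u} vp u≺v =
    subst (label u <_) (sym (label-child vp)) (s≤s (∸-monoˡ-≤ roots (rank-mono-< u≺v)))

  -- Sums of the labels below a vertex

  childSum : Fin n → ℕ
  childSum v = sumOver (λ u → parent? u v) label

  childSum-inner : ∀ {v} (i : Inner v) → childSum v ≡ label (Inner.child i)
  childSum-inner {v} i = sumOver-singleton (λ u → parent? u v) label child hasChild unique
    where open Inner i

  childCount-inner : ∀ {v} → Inner v → childCount v ≡ 1
  childCount-inner {v} i = sumOver-singleton (λ u → parent? u v) (λ _ → 1) child hasChild unique
    where open Inner i

  upper≢hub : ∀ {v} → role v ≡ upper → role v ≢ hub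
  upper≢hub p q with () ← trans (sym p) q

  lower≢hub : ∀ {v} → role v ≡ lower → role v ≢ hub
  lower≢hub p q with () ← trans (sym p) q

  key-innerChild : ∀ {v r} (i : Inner v) → role v ≡ r →
    key (Inner.child i) ≡ edge (level r) 1 (key v) (suc (toℕ (Inner.child i)))
  key-innerChild {v} {r} i v≡r = trans (key-child (Inner.hasChild i) v≡r)
    (cong (λ d → edge (level r) d (key v) (suc (toℕ (Inner.child i)))) (childCount-inner i))

  upper-childSum-mono : ∀ {u v} → role u ≡ upper → role v ≡ upper → key u ≺ key v → childSum u < childSum v
  upper-childSum-mono {u} {v} u≡ v≡ u≺v = subst₂ _<_ (sym (childSum-inner innerᵘ)) (sym (childSum-inner innerᵛ))
    (label-mono-< (Inner.hasChild innerᵛ)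
      (subst₂ _≺_ (sym (key-innerChild innerᵘ u≡)) (sym (key-innerChild innerᵛ v≡)) (by-parent (λ ()) u≺v)))
    where
    innerᵘ = inner (upper≢hub u≡)
    innerᵛ = inner (upper≢hub v≡)

  lower-childSum-anti : ∀ {u v} → role u ≡ lower → role v ≡ lower → key u ≺ key v → childSum v < childSum u
  lower-childSum-anti {u} {v} u≡ v≡ u≺v = subst₂ _<_ (sym (childSum-inner innerᵛ)) (sym (childSum-inner innerᵘ))
    (label-mono-< (Inner.hasChild innerᵘ)
      (subst₂ _≺_ (sym (key-innerChild innerᵛ v≡)) (sym (key-innerChild innerᵘ u≡)) (reversed u≺v)))
    where
    innerᵘ = inner (lower≢hub u≡)
    innerᵛ = inner (lower≢hub v≡)

  kind-mono : ∀ {u v p q} → Parent u p → Parent v q → level (role p) < level (role q) → label u < label v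
  kind-mono up vq p<q =
    label-mono-< vq (subst₂ _≺_ (sym (key-child up refl)) (sym (key-child vq refl)) (by-kind p<q))

  label-positive : ∀ {v p} → Parent v p → 0 < label v
  label-positive vp = subst (0 <_) (sym (label-child vp)) z<s

  upper-parent : ∀ {v p} → role v ≡ upper → Parent v p → role p ≡ hub
  upper-parent {v} {p} v≡ vp with role p in eq
  ... | hub   = refl
  ... | lower = contradiction (trans (sym v≡) (role-below-lower vp eq)) λ ()
  ... | upper with role-below-upper vp eq
  ... | inj₁ (v≡lower , _) = contradiction (trans (sym v≡) v≡lower) λ ()
  ... | inj₂ (v≡hub , _)   = contradiction (trans (sym v≡) v≡hub) λ ()

  lower-parent : ∀ {v p} → role v ≡ lower → Parent v p → role p ≡ upper
  lower-parent {v} {p} v≡ vp with role p in eq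
  ... | upper = refl
  ... | hub   = contradiction (trans (sym v≡) (role-below-hub vp eq)) λ ()
  ... | lower = contradiction (trans (sym v≡) (role-below-lower vp eq)) λ ()

  lower-label<childSum : ∀ {v} → role v ≡ lower → label v < childSum v
  lower-label<childSum {v} v≡ = subst (label v <_) (sym (childSum-inner innerᵛ))
    (kind-mono hasParent hasChild (subst₂ (λ r r′ → level r < level r′) (sym (lower-parent v≡ hasParent)) (sym v≡) z<s))
    where
    innerᵛ = inner (lower≢hub v≡)
    open Inner innerᵛ

  lower-childSum<upper-label : ∀ {u v} → role u ≡ lower → role v ≡ upper → childSum u < label v
  lower-childSum<upper-label {u} {v} u≡ v≡ = subst (_< label v) (sym (childSum-inner innerᵘ))
    (kind-mono (Inner.hasChild innerᵘ) (Inner.hasParent innerᵛ)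
      (subst₂ (λ r r′ → level r < level r′) (sym u≡) (sym (upper-parent v≡ (Inner.hasParent innerᵛ))) ≤-refl))
    where
    innerᵘ = inner (lower≢hub u≡)
    innerᵛ = inner (upper≢hub v≡)

  -- Comparison of the sums at two hubs

  module _ {w w′} (w≡hub : role w ≡ hub) (w′≡hub : role w′ ≡ hub) where

    private
      d  = childCount w
      d′ = childCount w′

      -- Below the keys of all children of w′, whose indices are positive.
      κ : Key
      κ = edge 2 d′ (key w′) 0

      -- A threshold: labels with keys before `κ` are at most `M`, and those of the children of `w′`
      -- exceed it.
      M : ℕ
      M = rank κ ∸ roots

      label≤M : ∀ {u} → key u ≺ κ → label u ≤ M
      label≤M u≺κ = ∸-monoˡ-≤ roots (rank-mono-< u≺κ)

      childSum≤ : d < d′ ⊎ d ≡ d′ × key w ≺ key w′ → childSum w ≤ d * M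
      childSum≤ cmp = subst (childSum w ≤_) (sumOver-const (λ u → parent? u w) M)
        (sumOver-mono-≤ (λ u → parent? u w) (λ u → parent? u w)
          (λ u uw → uw , label≤M (subst (_≺ κ) (sym (key-child uw w≡hub)) (go cmp))))
        where
        go : d < d′ ⊎ d ≡ d′ × key w ≺ key w′ → ∀ {i} → edge 2 d (key w) i ≺ κ
        go (inj₁ d<d′) = by-degree d<d′
        go (inj₂ (d≡d′ , w≺w′)) {i} = subst (λ e → edge 2 e (key w) i ≺ κ) (sym d≡d′) (by-parent (λ ()) w≺w′)

      ≤childSum : d′ * suc M ≤ childSum w′
      ≤childSum = subst (_≤ childSum w′) (sumOver-const (λ u → parent? u w′) (suc M))
        (sumOver-mono-≤ (λ u → parent? u w′) (λ u → parent? u w′)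
          (λ u uw′ → uw′ , subst (suc M ≤_) (sym (label-child uw′))
            (s≤s (∸-monoˡ-≤ roots (rank-mono-≤ (subst (κ ≺_) (sym (key-child uw′ w′≡hub)) (by-index z<s)))))))

      ownLabel≤M : label w ≤ M
      ownLabel≤M with hasParent? w
      ... | no ∄ = subst (_≤ M) (sym (label-root ∄)) z≤n
      -- The parent of a hub is no hub, so the edge above `w` has a smaller kind than the edges
      -- below hubs.
      ... | yes (p , wp) = label≤M (subst (_≺ κ) (sym (key-child wp refl)) (by-kind (p<2 (role p) refl)))
        where
        p<2 : ∀ r → role p ≡ r → level r < 2
        p<2 upper _ = z<s
        p<2 lower _ = ≤-refl
        p<2 hub p≡hub = contradiction (trans (sym w≡hub) (role-below-hub wp p≡hub)) λ ()

    -- The sum at `w` adds up `d + 1` numbers of at most `M`, and the sum at `w′` includes `d′ > d`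
    -- labels above `M`.
    hubSum-mono-children : d < d′ → label w + childSum w < label w′ + childSum w′
    hubSum-mono-children d<d′ = begin-strict
      label w + childSum w     ≤⟨ +-mono-≤ ownLabel≤M (childSum≤ (inj₁ d<d′)) ⟩
      suc d * M                ≤⟨ *-monoˡ-≤ M d<d′ ⟩
      d′ * M                   <⟨ *-monoʳ-< d′ {{>-nonZero (≤-<-trans z≤n d<d′)}} ≤-refl ⟩
      d′ * suc M               ≤⟨ ≤childSum ⟩
      childSum w′              ≤⟨ m≤n+m (childSum w′) (label w′) ⟩
      label w′ + childSum w′   ∎
      where open ≤-Reasoning

    module _ (d≡d′ : d ≡ d′) (w≺w′ : key w ≺ key w′) where

      -- Neither summand decreases from `w` to `w′`. The own label grows strictly if `w′` is not a
      -- root, the sum over the children if there are any.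
      hubSum-mono-equal : HasParent w′ ⊎ 0 < d′ → label w + childSum w < label w′ + childSum w′
      hubSum-mono-equal (inj₁ (_ , w′p)) = +-mono-<-≤ (label-mono-< w′p w≺w′) (begin
        childSum w    ≤⟨ childSum≤ (inj₂ (d≡d′ , w≺w′)) ⟩
        d * M         ≡⟨ cong (_* M) d≡d′ ⟩
        d′ * M        ≤⟨ *-monoʳ-≤ d′ (n≤1+n M) ⟩
        d′ * suc M    ≤⟨ ≤childSum ⟩
        childSum w′   ∎)
        where open ≤-Reasoning
      hubSum-mono-equal (inj₂ d′>0) = begin-strict
        label w + childSum w     ≤⟨ +-mono-≤ (label-mono-≤ w≺w′) (childSum≤ (inj₂ (d≡d′ , w≺w′))) ⟩
        label w′ + d * M         ≡⟨ cong (λ e → label w′ + e * M) d≡d′ ⟩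
        label w′ + d′ * M        <⟨ +-monoʳ-< (label w′) (*-monoʳ-< d′ {{>-nonZero d′>0}} ≤-refl) ⟩
        label w′ + d′ * suc M    ≤⟨ +-monoʳ-≤ (label w′) ≤childSum ⟩
        label w′ + childSum w′   ∎
        where open ≤-Reasoning

-- The orientation and its vertex sums

module Antimagic {n : ℕ} (F : Graph n)
  (elimination : Rooting.Elimination F (λ _ → ⊤) n)
  (independent : Independent F (λ v → degree F v ≢ 2))
  (atMostOneIsolated : ∀ u v → Isolated F u → Isolated F v → u ≡ v)
  where

  open Rooting F using (adj?)
  open Labelling F elimination independent

  -- Orientation by levels

  _⊏_ : Fin n → Fin n → Set
  u ⊏ v = level (role u) < level (role v)

  parent-comparable : ∀ {v p} → Parent v p → p ⊏ v ⊎ v ⊏ p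
  parent-comparable {v} {p} vp with role p in eq
  ... | hub rewrite role-below-hub vp eq = inj₂ z<s
  ... | lower rewrite role-below-lower vp eq = inj₁ ≤-refl
  ... | upper with role-below-upper vp eq
  ... | inj₁ (v≡lower , _) rewrite v≡lower = inj₁ z<s
  ... | inj₂ (v≡hub , _)   rewrite v≡hub   = inj₁ z<s

  adj-comparable : ∀ {u v} → Adj F u v → u ⊏ v ⊎ v ⊏ u
  adj-comparable uv with adj⇒parent uv
  ... | inj₁ u-child = swap (parent-comparable u-child)
  ... | inj₂ v-child = parent-comparable v-child

  arc : Fin n → Fin n → Bool
  arc u v = adj F u v ∧ (level (role u) <ᵇ level (role v))

  mkArc : ∀ {u v} → Adj F u v → u ⊏ v → T (arc u v)
  mkArc uv u⊏v = Equivalence.from T-∧ (uv , <⇒<ᵇ u⊏v)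

  arc⇒adj : ∀ {u v} → T (arc u v) → Adj F u v
  arc⇒adj a = proj₁ (Equivalence.to T-∧ a)

  arc⇒⊏ : ∀ {u v} → T (arc u v) → u ⊏ v
  arc⇒⊏ {u} {v} a = <ᵇ⇒< (level (role u)) (level (role v)) (proj₂ (Equivalence.to (T-∧ {adj F u v}) a))

  orientation : Digraph n
  orientation = record
    { arc        = arc
    ; asymmetric = λ uv vu → <-asym (arc⇒⊏ uv) (arc⇒⊏ vu)
    }

  open Digraph orientation using (Arc; asymmetric; labelAt; labelling; vertexSum)

  isOrientation : orientation IsOrientationOf F
  isOrientation u v = mk⇔
    (λ uv → map (mkArc uv) (mkArc (symmetric F uv)) (adj-comparable uv))
    [ arc⇒adj , symmetric F ∘ arc⇒adj ]

  -- Every edge is identified by its end further from the root, which turns arcs into vertices with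
  -- a parent.
  childEnd : (a : Arc) → ∃[ c ] HasParent c
  childEnd ((u , v) , a) with adj⇒parent (arc⇒adj a)
  ... | inj₁ uv = u , v , uv
  ... | inj₂ vu = v , u , vu

  childEnd-tail : ∀ {u v} (a : T (arc u v)) → Parent u v → proj₁ (childEnd ((u , v) , a)) ≡ u
  childEnd-tail a uv with adj⇒parent (arc⇒adj a)
  ... | inj₁ _  = refl
  ... | inj₂ vu = contradiction vu (parent-asym uv)

  childEnd-head : ∀ {u v} (a : T (arc u v)) → Parent v u → proj₁ (childEnd ((u , v) , a)) ≡ v
  childEnd-head a vu with adj⇒parent (arc⇒adj a)
  ... | inj₁ uv = contradiction uv (parent-asym vu)
  ... | inj₂ _  = refl

  arc-≡ : ∀ {u v u′ v′} (a : T (arc u v)) (a′ : T (arc u′ v′)) → u ≡ u′ → v ≡ v′ →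
    _≡_ {A = Arc} ((u , v) , a) ((u′ , v′) , a′)
  arc-≡ {u} {v} a a′ refl refl = cong ((u , v) ,_) (T-irrelevant a a′)

  childEnd-injective : ∀ a a′ → proj₁ (childEnd a) ≡ proj₁ (childEnd a′) → a ≡ a′
  childEnd-injective ((u , v) , a) ((u′ , v′) , a′) eq
    with adj⇒parent (arc⇒adj a) | adj⇒parent (arc⇒adj a′)
  ... | inj₁ uv | inj₁ uv′ = arc-≡ a a′ eq (parent-unique (subst (λ x → Parent x v) eq uv) uv′)
  ... | inj₂ vu | inj₂ vu′ = arc-≡ a a′ (parent-unique (subst (λ x → Parent x u) eq vu) vu′) eq
  -- The two arcs would be opposite ones on the same edge.
  ... | inj₁ uv | inj₂ vu′ with refl ← eq with refl ← parent-unique uv vu′ = contradiction a′ (asymmetric a)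
  ... | inj₂ vu | inj₁ uv′ with refl ← eq with refl ← parent-unique vu uv′ = contradiction a′ (asymmetric a)

  -- The labelling as a bijection

  rank-injective : ∀ {u v} → rank (key u) ≡ rank (key v) → u ≡ v
  rank-injective {u} {v} eq = decidable-stable (u ≟ᶠ v) λ u≢v →
    [ (λ u≺v → <⇒≢ (rank-mono-< u≺v) eq) , (λ v≺u → <⇒≢ (rank-mono-< v≺u) (sym eq)) ] (≺-total u≢v)

  edgeRank< : ∀ {v} → HasParent v → rank (key v) ∸ roots < n ∸ roots
  edgeRank< {v} (_ , vp) = ∸-monoˡ-< (rank<n v) (roots≤rank-child vp)

  index : Arc → Fin (n ∸ roots)
  index a = fromℕ< (edgeRank< (proj₂ (childEnd a)))

  toℕ-index : ∀ a → toℕ (index a) ≡ rank (key (proj₁ (childEnd a))) ∸ roots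
  toℕ-index a = toℕ-fromℕ< (edgeRank< (proj₂ (childEnd a)))

  index-injective : Injective _≡_ _≡_ index
  index-injective {a} {a′} eq = childEnd-injective a a′ (rank-injective
    (∸-cancelʳ-≡ (roots≤rank-child (proj₂ (proj₂ (childEnd a)))) (roots≤rank-child (proj₂ (proj₂ (childEnd a′))))
      (trans (sym (toℕ-index a)) (trans (cong toℕ eq) (toℕ-index a′)))))

  -- The ranks of the n vertices are distinct and below n, so some vertex has rank `roots + toℕ y`;
  -- it is no root, since roots have smaller ranks.
  index-surjective : ∀ y → ∃[ a ] index a ≡ y
  index-surjective y = go (hasParent? c)
    where
    roots+y<n : roots + toℕ y < n
    roots+y<n = subst (_≤ n) (cong suc (+-comm (toℕ y) roots)) (m≤o∸n⇒m+n≤o (suc (toℕ y)) roots≤n (toℕ<n y))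

    preimage : ∃[ v ] fromℕ< (rank<n v) ≡ fromℕ< roots+y<n
    preimage = injective⇒surjective
      (λ {u} {v} eq → rank-injective (fromℕ<-injective _ _ (rank<n u) (rank<n v) eq)) (fromℕ< roots+y<n)

    c : Fin n
    c = proj₁ preimage

    rank-c : rank (key c) ≡ roots + toℕ y
    rank-c = fromℕ<-injective _ _ (rank<n c) roots+y<n (proj₂ preimage)

    index≡ : ∀ a → proj₁ (childEnd a) ≡ c → index a ≡ y
    index≡ a eq = toℕ-injective (begin
      toℕ (index a)                               ≡⟨ toℕ-index a ⟩
      rank (key (proj₁ (childEnd a))) ∸ roots     ≡⟨ cong (λ v → rank (key v) ∸ roots) eq ⟩
      rank (key c) ∸ roots                        ≡⟨ cong (_∸ roots) rank-c ⟩
      roots + toℕ y ∸ roots                       ≡⟨ m+n∸m≡n roots (toℕ y) ⟩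
      toℕ y                                       ∎)
      where open ≡-Reasoning

    go : Dec (HasParent c) → ∃[ a ] index a ≡ y
    go (no ∄) = contradiction (subst (_< roots) rank-c (rank-root<roots ∄)) (≤⇒≯ (m≤m+n roots (toℕ y)))
    go (yes (p , cp)) with parent-comparable cp
    ... | inj₁ p⊏c = let a = mkArc (symmetric F (proj₁ cp)) p⊏c in ((p , c) , a) , index≡ _ (childEnd-head a cp)
    ... | inj₂ c⊏p = let a = mkArc (proj₁ cp) c⊏p in ((c , p) , a) , index≡ _ (childEnd-tail a cp)

  τ : Arc ⤖ Fin (n ∸ roots)
  τ = mk⤖ (index-injective , strictlySurjective⇒surjective index-surjective)

  -- Vertex sums by role

  ℓ : Fin n → Fin n → ℕ
  ℓ = labelAt (labelling τ)

  labelling≡label : ∀ a → labelling τ a ≡ label (proj₁ (childEnd a))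
  labelling≡label a = trans (cong suc (toℕ-index a)) (sym (label-child (proj₂ (proj₂ (childEnd a)))))

  ℓ-arc : ∀ {u v} (a : T (arc u v)) → ℓ u v ≡ label (proj₁ (childEnd ((u , v) , a)))
  ℓ-arc {u} {v} a with T? (arc u v)
  ... | yes a′ = trans (labelling≡label _) (cong (λ b → label (proj₁ (childEnd ((u , v) , b)))) (T-irrelevant a′ a))
  ... | no ¬a  = contradiction a ¬a

  ℓ-none : ∀ {u v} → ¬ T (arc u v) → ℓ u v ≡ 0
  ℓ-none {u} {v} ¬a with T? (arc u v)
  ... | yes a = contradiction a ¬a
  ... | no _  = refl

  ℓ-⊐ : ∀ {u v} → v ⊏ u → ℓ u v ≡ 0
  ℓ-⊐ v⊏u = ℓ-none (λ a → <-asym v⊏u (arc⇒⊏ a))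

  ℓ-¬adj : ∀ {u v} → ¬ Adj F u v → ℓ u v ≡ 0
  ℓ-¬adj ¬uv = ℓ-none (¬uv ∘ arc⇒adj)

  ℓ-up : ∀ {u v} → Parent u v → u ⊏ v → ℓ u v ≡ label u
  ℓ-up uv u⊏v = let a = mkArc (proj₁ uv) u⊏v in trans (ℓ-arc a) (cong label (childEnd-tail a uv))

  ℓ-down : ∀ {u v} → Parent v u → u ⊏ v → ℓ u v ≡ label v
  ℓ-down vu u⊏v = let a = mkArc (symmetric F (proj₁ vu)) u⊏v in trans (ℓ-arc a) (cong label (childEnd-head a vu))

  -- Only the parent and the children contribute. The share `x` of the parent is written as a sum
  -- over all parents, so that roots and other vertices are treated alike.
  incidentSum : ∀ v {f : Fin n → ℕ} (x : ℕ) (g : Fin n → ℕ) →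
    (∀ u → ¬ Adj F u v → f u ≡ 0) → (∀ u → Parent v u → f u ≡ x) → (∀ u → Parent u v → f u ≡ g u) →
    sum f ≡ sumOver (parent? v) (λ _ → x) + sumOver (λ u → parent? u v) g
  incidentSum v {f} x g none up down = trans (sum-cong-≗ pointwise)
    (∑-distrib-+ (λ u → restrict (parent? v u) x) (λ u → restrict (parent? u v) (g u)))
    where
    pointwise : ∀ u → f u ≡ restrict (parent? v u) x + restrict (parent? u v) (g u)
    pointwise u with adj? u v
    ... | no ¬uv = trans (none u ¬uv) (sym (cong₂ _+_
            (restrict-no (parent? v u) (¬uv ∘ symmetric F ∘ proj₁) x)
            (restrict-no (parent? u v) (¬uv ∘ proj₁) (g u))))
    ... | yes uv with adj⇒parent uv
    ... | inj₁ u-child = trans (down u u-child) (sym (cong₂ _+_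
            (restrict-no (parent? v u) (parent-asym u-child) x)
            (restrict-yes (parent? u v) u-child (g u))))
    ... | inj₂ v-child = trans (up u v-child) (trans (sym (+-identityʳ x)) (sym (cong₂ _+_
            (restrict-yes (parent? v u) v-child x)
            (restrict-no (parent? u v) (parent-asym v-child) (g u)))))

  sumOver-zero : ∀ {P : Pred (Fin n) 0ℓ} (P? : Decidable P) → sumOver P? (λ _ → 0) ≡ 0
  sumOver-zero P? = trans (sumOver-const P? 0) (*-zeroʳ (count P?))

  ownLabel : ∀ v → sumOver (parent? v) (λ _ → label v) ≡ label v
  ownLabel v with hasParent? v
  ... | no ∄ = trans (sumOver-empty (parent? v) _ (λ u vu → ∄ (u , vu))) (sym (label-root ∄))
  ... | yes (p , vp) = sumOver-singleton (parent? v) _ p vp (λ _ vu → parent-unique vu vp)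

  inSum outSum : Fin n → ℕ
  inSum v  = sum (λ u → ℓ u v)
  outSum v = sum (λ w → ℓ v w)

  module _ {v} (v≡ : role v ≡ hub) where

    neighbour⊏hub : ∀ {u} → Adj F u v → u ⊏ v
    neighbour⊏hub {u} uv with adj-comparable uv
    ... | inj₁ u⊏v = u⊏v
    ... | inj₂ v⊏u = contradiction (subst (λ r → level r < level (role u)) v≡ v⊏u) (hub-top (role u))
      where
      hub-top : ∀ r → ¬ (2 < level r)
      hub-top hub (s≤s (s≤s ()))
      hub-top lower (s≤s ())

    inSum-hub : inSum v ≡ label v + childSum v
    inSum-hub = trans (incidentSum v (label v) label (λ _ → ℓ-¬adj)
      (λ u vu → ℓ-down vu (neighbour⊏hub (symmetric F (proj₁ vu))))
      (λ u uv → ℓ-up uv (neighbour⊏hub (proj₁ uv)))) (cong (_+ childSum v) (ownLabel v))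

    outSum-hub : outSum v ≡ 0
    outSum-hub = sum-zero zeros
      where
      zeros : ∀ w → ℓ v w ≡ 0
      zeros w with adj? v w
      ... | no ¬vw = ℓ-¬adj ¬vw
      ... | yes vw = ℓ-⊐ (neighbour⊏hub (symmetric F vw))

  module _ {v} (v≡ : role v ≡ upper) where

    upper⊏neighbour : ∀ {u} → Adj F u v → v ⊏ u
    upper⊏neighbour {u} uv with adj-comparable uv
    ... | inj₂ v⊏u = v⊏u
    ... | inj₁ u⊏v = contradiction (subst (λ r → level (role u) < level r) v≡ u⊏v) λ ()

    outSum-upper : outSum v ≡ label v + childSum v
    outSum-upper = trans (incidentSum v (label v) label (λ _ ¬uv → ℓ-¬adj (¬uv ∘ symmetric F))
      (λ u vu → ℓ-up vu (upper⊏neighbour (symmetric F (proj₁ vu))))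
      (λ u uv → ℓ-down uv (upper⊏neighbour (proj₁ uv)))) (cong (_+ childSum v) (ownLabel v))

    inSum-upper : inSum v ≡ 0
    inSum-upper = sum-zero zeros
      where
      zeros : ∀ u → ℓ u v ≡ 0
      zeros u with adj? u v
      ... | no ¬uv = ℓ-¬adj ¬uv
      ... | yes uv = ℓ-⊐ (upper⊏neighbour uv)

  module _ {v} (v≡ : role v ≡ lower) where

    parent⊏lower : ∀ {p} → Parent v p → p ⊏ v
    parent⊏lower vp = subst₂ (λ r r′ → level r < level r′) (sym (lower-parent v≡ vp)) (sym v≡) z<s

    lower⊏child : ∀ {c} → Parent c v → v ⊏ c
    lower⊏child cv = subst₂ (λ r r′ → level r < level r′) (sym v≡) (sym (role-below-lower cv v≡)) ≤-refl

    inSum-lower : inSum v ≡ label v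
    inSum-lower = trans (incidentSum v (label v) (λ _ → 0) (λ _ → ℓ-¬adj)
      (λ u vu → ℓ-down vu (parent⊏lower vu)) (λ u uv → ℓ-⊐ (lower⊏child uv)))
      (trans (cong₂ _+_ (ownLabel v) (sumOver-zero (λ u → parent? u v))) (+-identityʳ _))

    outSum-lower : outSum v ≡ childSum v
    outSum-lower = trans (incidentSum v 0 label (λ _ ¬uv → ℓ-¬adj (¬uv ∘ symmetric F))
      (λ u vu → ℓ-⊐ (parent⊏lower vu)) (λ u uv → ℓ-down uv (lower⊏child uv)))
      (cong (_+ childSum v) (sumOver-zero (parent? v)))

  -- Separation of the vertex sums

  noChildren⇒isolated : ∀ {v} → ¬ HasParent v → childCount v ≡ 0 → Isolated F v
  noChildren⇒isolated {v} ∄ c≡0 = trans (degree≡count F v) (sumOver-empty (λ u → T? (adj F v u)) _ noNeighbour)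
    where
    noNeighbour : ∀ u → ¬ Adj F v u
    noNeighbour u vu with adj⇒parent vu
    ... | inj₁ v-child = ∄ (u , v-child)
    ... | inj₂ u-child = count≡0⇒empty (λ u → parent? u v) c≡0 u u-child

  hubSum-mono-≺ : ∀ {w w′} → role w ≡ hub → role w′ ≡ hub → childCount w ≡ childCount w′ → key w ≺ key w′ →
    label w + childSum w < label w′ + childSum w′
  hubSum-mono-≺ {w} {w′} w≡ w′≡ d≡d′ w≺w′ with hasParent? w′ | childCount w′ ≟ 0
  ... | yes w′p | _        = hubSum-mono-equal w≡ w′≡ d≡d′ w≺w′ (inj₁ w′p)
  ... | no _    | no d′≢0  = hubSum-mono-equal w≡ w′≡ d≡d′ w≺w′ (inj₂ (n≢0⇒n>0 d′≢0))
  -- Here `w′` is isolated. As only roots precede a root, `w` is a root too, without children, hence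
  -- isolated and equal to `w′`.
  ... | no ∄′   | yes d′≡0 = contradiction (subst (λ v → key v ≺ key w′) w≡w′ w≺w′) ≺-irrefl
    where
    ∄ : ¬ HasParent w
    ∄ (_ , wp) with () ← subst₂ _≺_ (key-child wp refl) (key-root w′ ∄′) w≺w′
    w≡w′ : w ≡ w′
    w≡w′ = atMostOneIsolated w w′ (noChildren⇒isolated ∄ (trans d≡d′ d′≡0)) (noChildren⇒isolated ∄′ d′≡0)

  hubSum-distinct : ∀ {w w′} → role w ≡ hub → role w′ ≡ hub → w ≢ w′ →
    label w + childSum w ≢ label w′ + childSum w′
  hubSum-distinct {w} {w′} w≡ w′≡ w≢w′ with <-cmp (childCount w) (childCount w′)
  ... | tri< d<d′ _ _ = <⇒≢ (hubSum-mono-children w≡ w′≡ d<d′)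
  ... | tri> _ _ d′<d = ≢-sym (<⇒≢ (hubSum-mono-children w′≡ w≡ d′<d))
  ... | tri≈ _ d≡d′ _ with ≺-total w≢w′
  ... | inj₁ w≺w′ = <⇒≢ (hubSum-mono-≺ w≡ w′≡ d≡d′ w≺w′)
  ... | inj₂ w′≺w = ≢-sym (<⇒≢ (hubSum-mono-≺ w′≡ w≡ (sym d≡d′) w′≺w))

  upperSum-mono : ∀ {u v} → role u ≡ upper → role v ≡ upper → key u ≺ key v →
    label u + childSum u < label v + childSum v
  upperSum-mono u≡ v≡ u≺v = +-mono-≤-< (label-mono-≤ u≺v) (upper-childSum-mono u≡ v≡ u≺v)

  lowerSum-mono : ∀ {u v} → role u ≡ lower → role v ≡ lower → key u ≺ key v →
    label u + childSum v < label v + childSum u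
  lowerSum-mono u≡ v≡ u≺v = +-mono-≤-< (label-mono-≤ u≺v) (lower-childSum-anti u≡ v≡ u≺v)

  upper-label-positive : ∀ {v} → role v ≡ upper → 0 < label v
  upper-label-positive v≡ = label-positive (Inner.hasParent (inner (upper≢hub v≡)))

  -- vertexSum u ≢ vertexSum v with both sides moved so that no subtraction occurs.
  Apart : Fin n → Fin n → Set
  Apart u v = inSum u + outSum v ≢ inSum v + outSum u

  apart-by : ∀ {u v a b c d} → inSum u ≡ a → outSum u ≡ b → inSum v ≡ c → outSum v ≡ d →
    a + d ≢ c + b → Apart u v
  apart-by refl refl refl refl a+d≢c+b = a+d≢c+b

  hub-hub : ∀ {u v} → role u ≡ hub → role v ≡ hub → u ≢ v → Apart u v
  hub-hub u≡ v≡ u≢v = apart-by (inSum-hub u≡) (outSum-hub u≡) (inSum-hub v≡) (outSum-hub v≡)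
    (hubSum-distinct u≡ v≡ u≢v ∘ +-cancelʳ-≡ 0 _ _)

  -- Sums at hubs are at least 0, those at `upper` vertices negative.
  hub-upper : ∀ {u v} → role u ≡ hub → role v ≡ upper → Apart u v
  hub-upper {u} {v} u≡ v≡ = apart-by (inSum-hub u≡) (outSum-hub u≡) (inSum-upper v≡) (outSum-upper v≡)
    (≢-sym (<⇒≢ (<-≤-trans (upper-label-positive v≡)
      (≤-trans (m≤m+n (label v) (childSum v)) (m≤n+m (label v + childSum v) (label u + childSum u))))))

  hub-lower : ∀ {u v} → role u ≡ hub → role v ≡ lower → Apart u v
  hub-lower {u} {v} u≡ v≡ = apart-by (inSum-hub u≡) (outSum-hub u≡) (inSum-lower v≡) (outSum-lower v≡)
    (≢-sym (<⇒≢ (<-≤-trans (subst (_< childSum v) (sym (+-identityʳ (label v))) (lower-label<childSum v≡))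
      (m≤n+m (childSum v) (label u + childSum u)))))

  upper-upper : ∀ {u v} → role u ≡ upper → role v ≡ upper → u ≢ v → Apart u v
  upper-upper u≡ v≡ u≢v = apart-by (inSum-upper u≡) (outSum-upper u≡) (inSum-upper v≡) (outSum-upper v≡)
    ([ ≢-sym ∘ <⇒≢ ∘ upperSum-mono u≡ v≡ , <⇒≢ ∘ upperSum-mono v≡ u≡ ] (≺-total u≢v))

  -- The sum at `v` is at least `- childSum v`, which exceeds `- label u`, an upper bound of the sum
  -- at `u`.
  upper-lower : ∀ {u v} → role u ≡ upper → role v ≡ lower → Apart u v
  upper-lower {u} {v} u≡ v≡ = apart-by (inSum-upper u≡) (outSum-upper u≡) (inSum-lower v≡) (outSum-lower v≡)
    (<⇒≢ (<-≤-trans (lower-childSum<upper-label v≡ u≡)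
      (≤-trans (m≤m+n (label u) (childSum u)) (m≤n+m (label u + childSum u) (label v)))))

  lower-lower : ∀ {u v} → role u ≡ lower → role v ≡ lower → u ≢ v → Apart u v
  lower-lower u≡ v≡ u≢v = apart-by (inSum-lower u≡) (outSum-lower u≡) (inSum-lower v≡) (outSum-lower v≡)
    ([ <⇒≢ ∘ lowerSum-mono u≡ v≡ , ≢-sym ∘ <⇒≢ ∘ lowerSum-mono v≡ u≡ ] (≺-total u≢v))

  apart : ∀ u v → u ≢ v → Apart u v
  apart u v u≢v = by-roles (role u) (role v) refl refl
    where
    by-roles : ∀ r s → role u ≡ r → role v ≡ s → Apart u v
    by-roles hub   hub   u≡ v≡ = hub-hub u≡ v≡ u≢v
    by-roles hub   upper u≡ v≡ = hub-upper u≡ v≡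
    by-roles hub   lower u≡ v≡ = hub-lower u≡ v≡
    by-roles upper hub   u≡ v≡ = ≢-sym (hub-upper v≡ u≡)
    by-roles upper upper u≡ v≡ = upper-upper u≡ v≡ u≢v
    by-roles upper lower u≡ v≡ = upper-lower u≡ v≡
    by-roles lower hub   u≡ v≡ = ≢-sym (hub-lower v≡ u≡)
    by-roles lower upper u≡ v≡ = ≢-sym (upper-lower v≡ u≡)
    by-roles lower lower u≡ v≡ = lower-lower u≡ v≡ u≢v

  antimagic : AdmitsAntimagicOrientation F
  antimagic = orientation , isOrientation , n ∸ roots , τ ,
    λ u v u≢v eq → apart u v u≢v (difference-cross (inSum u) (outSum u) (inSum v) (outSum v) eq)

theorem1p2 : ∀ (n : ℕ) (F : Graph n) →
    IsForest F →
    (∀ (u v : Fin n) → Isolated F u → Isolated F v → u ≡ v) →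
    Independent F (λ v → degree F v ≢ 2) →
    AdmitsAntimagicOrientation F
theorem1p2 n F forest atMostOneIsolated independent =
  Antimagic.antimagic F elimination independent atMostOneIsolated
  where
  open Rooting F
  elimination : Elimination (λ _ → ⊤) n
  elimination = eliminate forest n (λ _ → yes tt) (≤-reflexive (count-all n))
    (λ u _ deg≡2 → hasNeighbour u deg≡2)
    -- Nothing has been deleted yet, so all vertices are full.
    (λ u _ _ _ ¬full → contradiction (λ _ _ _ → tt) ¬full)
    where
    hasNeighbour : ∀ u → degree F u ≡ 2 → ∃[ y ] ⊤ × Adj F u y
    hasNeighbour u deg≡2 with any? (adj? u)
    ... | yes (y , uy) = y , tt , uy
    ... | no ∄ = contradiction (trans (sym deg≡2) (trans (degree≡count F u)
                   (sumOver-empty (adj? u) _ (λ y uy → ∄ (y , uy))))) λ ()
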